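{- For every integer $n \ge 1$, let $$a(n) = \sum_{k=1}^n \frac{\operatorname{lcm}(n, n-1, \ldots, n-k+2, n-k+1)}{\operatorname{lcm}(1,2,\ldots,k)}.$$ Then $a(n) \equiv 1 - m(n) \pmod 2$ for all $n \ge 1$.
   Context: For a non-negative integer $k$, $s_2(k)$ denotes the number of ones in the binary expansion of $k$. Define $\bar{t}(k) = 1$ if $s_2(k)$ is even and $\bar{t}(k)=0$ if $s_2(k)$ is odd. The sequence $m(n)$, $n \ge 0$, is defined by $m(2k) = \bar{t}(k)$ and $m(2k+1) = 0$ for all $k \ge 0$. Each term of the sum defining $a(n)$ is an integer. The sequence $a(n)$ is OEIS A093431, indexed from $n=1$: $1,3,7,13,31,38,113,165,\ldots$. -}

module Defs where

open import Data.Digit using (toDigits; 1b)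
open import Data.Fin.Properties using (_≟_)
open import Data.List.Base using (List; []; _∷_; applyUpTo; filter; foldr; length)
open import Data.List.Membership.Propositional using (_∈_)
open import Data.List.Membership.Propositional.Properties using (∈-applyUpTo⁺)
open import Data.List.Relation.Unary.All using (All; []; _∷_)
open import Data.List.Relation.Unary.All.Properties using (applyUpTo⁺₁; applyUpTo⁺₂)
open import Data.List.Relation.Unary.Any using (here; there)
open import Data.Nat.Base
open import Data.Nat.DivMod using (m≡m%n+[m/n]*n; m%n<n; m/n*n≡m)
open import Data.Nat.Divisibility
open import Data.Nat.LCM using (lcm; m∣lcm[m,n]; n∣lcm[m,n]; lcm-least)
open import Data.Nat.ListAction using (sum)
open import Data.Nat.Properties
  using (+-identityʳ; n≡⌊n+n/2⌋; m*n≢0; m*n≢0⇒n≢0; <-≤-trans; m+n∸m≡n)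
open import Data.Parity.Base using (0ℙ; 1ℙ)
open import Data.Parity.Properties using (*-homo-*; suc-homo-⁻¹; ⁻¹-selfInverse)
open import Data.Product.Base using (proj₁)
open import Function.Base using (_∘_)
open import Relation.Binary.PropositionalEquality using (_≡_; refl; sym; trans; cong; subst)

s₂ : ℕ → ℕ
s₂ k = length (filter (_≟ 1b) (proj₁ (toDigits 2 k)))

t̄ : ℕ → ℕ
t̄ k with parity (s₂ k)
... | 0ℙ = 1
... | 1ℙ = 0

m : ℕ → ℕ
m n with parity n
... | 0ℙ = t̄ ⌊ n /2⌋
... | 1ℙ = 0

private
  parity-2* : ∀ k → parity (2 * k) ≡ 0ℙ
  parity-2* = *-homo-* 2

m-even : ∀ k → m (2 * k) ≡ t̄ k
m-even k rewrite parity-2* k | +-identityʳ k = cong t̄ (sym (n≡⌊n+n/2⌋ k))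

m-odd : ∀ k → m (suc (2 * k)) ≡ 0
m-odd k rewrite sym (⁻¹-selfInverse (trans (suc-homo-⁻¹ (2 * k)) (parity-2* k))) = refl

lcms : List ℕ → ℕ
lcms = foldr lcm 1

-- lcm (n, n - 1, …, n - k + 1); the subtraction never truncates for k ≤ n.
lcmDown : ℕ → ℕ → ℕ
lcmDown n k = lcms (applyUpTo (n ∸_) k)

-- lcm (1, 2, …, k)
lcmUpTo : ℕ → ℕ
lcmUpTo k = lcms (applyUpTo suc k)

private
  lcm≢0 : ∀ i j .{{_ : NonZero i}} .{{_ : NonZero j}} → NonZero (lcm i j)
  lcm≢0 i j = m*n≢0⇒n≢0 (quotient l∣ij) {{subst NonZero (m∣n⇒n≡quotient*m l∣ij) (m*n≢0 i j)}}
    where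
    l∣ij : lcm i j ∣ i * j
    l∣ij = lcm-least {i} {j} (m∣m*n j) (n∣m*n i)

  lcms≢0 : ∀ {xs} → All NonZero xs → NonZero (lcms xs)
  lcms≢0 []                    = _
  lcms≢0 {x ∷ xs} (x≢0 ∷ xs≢0) = lcm≢0 x (lcms xs) {{x≢0}} {{lcms≢0 xs≢0}}

  ∈⇒∣lcms : ∀ {x xs} → x ∈ xs → x ∣ lcms xs
  ∈⇒∣lcms {x} {_ ∷ xs} (here refl)  = m∣lcm[m,n] x (lcms xs)
  ∈⇒∣lcms {_} {y ∷ xs} (there x∈xs) = ∣-trans (∈⇒∣lcms x∈xs) (n∣lcm[m,n] y (lcms xs))

  lcms-least : ∀ {c xs} → All (_∣ c) xs → lcms xs ∣ c
  lcms-least []            = 1∣ _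
  lcms-least (x∣c ∷ xs∣c) = lcm-least x∣c (lcms-least xs∣c)

lcmUpTo≢0 : ∀ k → NonZero (lcmUpTo k)
lcmUpTo≢0 k = lcms≢0 (applyUpTo⁺₂ suc k (λ _ → _))

lcmUpTo∣lcmDown : ∀ n k → lcmUpTo k ∣ lcmDown n k
lcmUpTo∣lcmDown n k = lcms-least (applyUpTo⁺₁ suc k d∣lcmDown)
  where
  d∣lcmDown : ∀ {i} → i < k → suc i ∣ lcmDown n k
  d∣lcmDown {i} i<k =
    ∣-trans (divides (n / d) n∸r≡qd) (∈⇒∣lcms (∈-applyUpTo⁺ (n ∸_) (<-≤-trans (m%n<n n d) i<k)))
    where
    d = suc i
    n∸r≡qd : n ∸ n % d ≡ n / d * d
    n∸r≡qd = trans (cong (_∸ n % d) (m≡m%n+[m/n]*n n d)) (m+n∸m≡n (n % d) (n / d * d))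

-- The division is exact, see term-exact.
term : ℕ → ℕ → ℕ
term n k = lcmDown n k / lcmUpTo k
  where instance _ = lcmUpTo≢0 k

term-exact : ∀ n k → term n k * lcmUpTo k ≡ lcmDown n k
term-exact n k = m/n*n≡m (lcmUpTo∣lcmDown n k)
  where instance _ = lcmUpTo≢0 k

-- applyUpTo starts at 0, hence the shift to k = 1, …, n.
a : ℕ → ℕ
a n = sum (applyUpTo (term n ∘ suc) n)

{-# OPTIONS --safe #-}

-- Let 2^e ≤ k < 2^(e+1). The exact power of 2 dividing lcm(1,…,k) is 2^e, so term n k is odd iff
-- no multiple of 2^(e+1) lies among n, n-1, …, n-k+1, that is, iff k ≤ n mod 2^(e+1).
-- The dyadic block of all such k therefore contributes (1 + n mod 2^(e+1)) ∸ 2^e odd terms.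
-- For odd n this is 1 for e = 0 and even for e > 0; for n = 2i it is 0 for e = 0 and, modulo 2,
-- the bit of index e - 1 of i for e > 0. Hence a n is odd for odd n, and a (2i) ≡ s₂ i.
module Submission where

open import Defs
open import Data.Nat.Base using (ℕ; _≥_)
open import Data.Integer.Base using (+_; 1ℤ; _-_)
open import Data.Integer.Divisibility.Signed using (_∣_)

open import Data.Digit using (Bit; Expansion; fromDigits; toDigits; 0b; 1b)
open import Data.Fin.Base using (toℕ; zero; suc)
import Data.Fin.Properties as Fin
import Data.Integer.Base as ℤ
import Data.Integer.Divisibility.Signed as ℤ
open import Data.Integer.Tactic.RingSolver using (solve-∀)
open import Data.List.Base using ([]; _∷_; applyUpTo; filter; length)
open import Data.List.Relation.Unary.Any using (Any; here; there)
open import Data.List.Relation.Unary.Any.Properties using (applyUpTo⁺; applyUpTo⁻)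
open import Data.Nat.Base
  using (zero; suc; _+_; _*_; _∸_; _^_; _/_; _%_; _≤_; _<_; NonZero; z≤n; s≤s; z<s; s<s;
         ≢-nonZero; >-nonZero; nonTrivial⇒≢1; parity)
open import Data.Nat.Coprimality using (coprime-/gcd)
open import Data.Nat.DivMod
open import Data.Nat.Divisibility
  using (_∤_; _∣?_; divides; divides-refl; _∣0; 1∣_; ∣-refl; ∣-trans; 0∣⇒≡0; ∣1⇒≡1; >⇒∤; ∣m⇒∣m*n;
         n∣m*n; *-monoˡ-∣; *-monoʳ-∣; *-cancelˡ-∣; *-pres-∣; ∣m∣n⇒∣m+n; ∣m+n∣m⇒∣n)
  renaming (_∣_ to _∣ℕ_)
open import Data.Nat.GCD using (gcd; gcd[m,n]∣m; gcd[m,n]∣n; gcd[m,n]≢0)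
open import Data.Nat.LCM using (lcm; m∣lcm[m,n]; n∣lcm[m,n]; lcm-least)
open import Data.Nat.ListAction using (sum)
open import Data.Nat.Primality using (Prime; euclidsLemma; prime[2]; prime⇒nonZero; prime⇒nonTrivial)
open import Data.Nat.Properties
open import Data.Parity.Base using (0ℙ; 1ℙ; _⁻¹) renaming (_+_ to _+ℙ_)
import Data.Parity.Properties as ℙ
open import Data.Product.Base using (_,_)
open import Data.Sum.Base using (_⊎_; inj₁; inj₂)
open import Function.Base using (_∘_; case_of_)
open import Relation.Binary.PropositionalEquality
  using (_≡_; refl; sym; trans; cong; cong₂; subst; module ≡-Reasoning)
open import Relation.Nullary using (yes; no; contradiction)

-- Prime powers and least common multiples

-- Induction on `j`: Euclid's lemma forces a factor `p` into `n`, and cancelling it on both sides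
-- leaves `p ^ j`.
prime^∣*⇒prime^∣ʳ : ∀ {p} → Prime p → ∀ j m n → p ∤ m → p ^ j ∣ℕ m * n → p ^ j ∣ℕ n
prime^∣*⇒prime^∣ʳ     pp zero    m n p∤m _ = 1∣ n
prime^∣*⇒prime^∣ʳ {p} pp (suc j) m n p∤m pʲ⁺¹∣mn
  with euclidsLemma m n pp (∣-trans (∣m⇒∣m*n (p ^ j) ∣-refl) pʲ⁺¹∣mn)
... | inj₁ p∣m = contradiction p∣m p∤m
... | inj₂ (divides-refl q) = subst (_∣ℕ q * p) (*-comm (p ^ j) p)
  (*-monoˡ-∣ p (prime^∣*⇒prime^∣ʳ pp j m q p∤m (*-cancelˡ-∣ p pp^j∣pmq)))
  where
  instance _ = prime⇒nonZero pp
  pp^j∣pmq : p * p ^ j ∣ℕ p * (m * q)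
  pp^j∣pmq = subst (p ^ suc j ∣ℕ_) (trans (sym (*-assoc m q p)) (*-comm (m * q) p)) pʲ⁺¹∣mn

gcd≢0 : ∀ m n .{{_ : NonZero m}} → NonZero (gcd m n)
gcd≢0 m@(suc _) n = ≢-nonZero (gcd[m,n]≢0 m n (inj₁ λ ()))

lcm∣m/gcd*n : ∀ m n .{{_ : NonZero (gcd m n)}} → lcm m n ∣ℕ m / gcd m n * n
lcm∣m/gcd*n m n = lcm-least
  (subst (_∣ℕ m / gcd m n * n) (m/n*n≡m (gcd[m,n]∣m m n)) (*-monoʳ-∣ (m / gcd m n) (gcd[m,n]∣n m n)))
  (n∣m*n (m / gcd m n))

lcm∣n/gcd*m : ∀ m n .{{_ : NonZero (gcd m n)}} → lcm m n ∣ℕ n / gcd m n * m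
lcm∣n/gcd*m m n = lcm-least
  (n∣m*n (n / gcd m n))
  (subst (_∣ℕ n / gcd m n * m) (m/n*n≡m (gcd[m,n]∣n m n)) (*-monoʳ-∣ (n / gcd m n) (gcd[m,n]∣m m n)))

-- With `g = gcd m n`, the cofactors `m / g` and `n / g` are coprime, so `p` misses one of them. The
-- lcm divides that cofactor times the opposite argument, which must then absorb all of `p ^ j`.
prime^∣lcm⇒∣⊎∣ : ∀ {p} → Prime p → ∀ j m n → p ^ j ∣ℕ lcm m n → p ^ j ∣ℕ m ⊎ p ^ j ∣ℕ n
prime^∣lcm⇒∣⊎∣     pp j zero      n _ = inj₁ (_ ∣0)
prime^∣lcm⇒∣⊎∣ {p} pp j m@(suc _) n pʲ∣lcm = case p ∣? (n / gcd m n) of λ where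
    (no  p∤n/g) → inj₁ (prime^∣*⇒prime^∣ʳ pp j (n / gcd m n) m p∤n/g
      (∣-trans pʲ∣lcm (lcm∣n/gcd*m m n)))
    (yes p∣n/g) → inj₂ (prime^∣*⇒prime^∣ʳ pp j (m / gcd m n) n
      (λ p∣m/g → nonTrivial⇒≢1 (coprime-/gcd m n (p∣m/g , p∣n/g)))
      (∣-trans pʲ∣lcm (lcm∣m/gcd*n m n)))
  where
  instance
    _ = gcd≢0 m n
    _ = prime⇒nonTrivial pp

-- The exponent is positive because `p ^ 0` divides the lcm of the empty list, which has no entry to
-- point to.
prime^∣lcms⇒Any∣ : ∀ {p} → Prime p → ∀ j xs → p ^ suc j ∣ℕ lcms xs → Any (p ^ suc j ∣ℕ_) xs
prime^∣lcms⇒Any∣ {p} pp j [] pʲ⁺¹∣1 =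
  contradiction (m*n≡1⇒m≡1 p (p ^ j) (∣1⇒≡1 pʲ⁺¹∣1)) nonTrivial⇒≢1
  where instance _ = prime⇒nonTrivial pp
prime^∣lcms⇒Any∣ pp j (x ∷ xs) pʲ⁺¹∣lcm with prime^∣lcm⇒∣⊎∣ pp (suc j) x (lcms xs) pʲ⁺¹∣lcm
... | inj₁ ∣x  = here ∣x
... | inj₂ ∣xs = there (prime^∣lcms⇒Any∣ pp j xs ∣xs)

Any∣⇒∣lcms : ∀ {d xs} → Any (d ∣ℕ_) xs → d ∣ℕ lcms xs
Any∣⇒∣lcms {xs = x ∷ xs} (here d∣x)  = ∣-trans d∣x (m∣lcm[m,n] x (lcms xs))
Any∣⇒∣lcms {xs = x ∷ xs} (there any) = ∣-trans (Any∣⇒∣lcms any) (n∣lcm[m,n] x (lcms xs))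

-- Parity of a single term

2∣⇒parity≡0 : ∀ {n} → 2 ∣ℕ n → parity n ≡ 0ℙ
2∣⇒parity≡0 (divides-refl q) = trans (ℙ.*-homo-* q 2) (ℙ.*-zeroʳ (parity q))

2∤⇒parity≡1 : ∀ n → 2 ∤ n → parity n ≡ 1ℙ
2∤⇒parity≡1 0             2∤n = contradiction (2 ∣0) 2∤n
2∤⇒parity≡1 1             2∤n = refl
2∤⇒parity≡1 (suc (suc n)) 2∤n = 2∤⇒parity≡1 n (2∤n ∘ ∣m∣n⇒∣m+n ∣-refl)

infixl 7 _mod2^_

_mod2^_ : ℕ → ℕ → ℕ
n mod2^ e = n % 2 ^ e
  where instance _ = m^n≢0 2 e

mod2^-< : ∀ n e → n mod2^ e < 2 ^ e
mod2^-< n e = m%n<n n (2 ^ e)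
  where instance _ = m^n≢0 2 e

mod2^-≤ : ∀ n e → n mod2^ e ≤ n
mod2^-≤ n e = m%n≤m n (2 ^ e)
  where instance _ = m^n≢0 2 e

2^∣n∸mod2^ : ∀ n e → 2 ^ e ∣ℕ n ∸ n mod2^ e
2^∣n∸mod2^ n e = divides (n / 2 ^ e)
  (trans (cong (_∸ n % 2 ^ e) (m≡m%n+[m/n]*n n (2 ^ e))) (m+n∸m≡n (n % 2 ^ e) (n / 2 ^ e * 2 ^ e)))
  where instance _ = m^n≢0 2 e

-- Since `n ∸ r` is a multiple of `2 ^ e`, the modulus would also divide `r ∸ i`, which is positive
-- and below `2 ^ e`.
2^∤n∸i : ∀ {n e i} → i < n mod2^ e → 2 ^ e ∤ n ∸ i
2^∤n∸i {n} {e} {i} i<r 2^e∣n∸i = >⇒∤ r∸i<2^e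
  (∣m+n∣m⇒∣n (subst (2 ^ e ∣ℕ_) n∸i≡ 2^e∣n∸i) (2^∣n∸mod2^ n e))
  where
  r = n mod2^ e
  instance _ = >-nonZero (m<n⇒0<n∸m i<r)
  r∸i<2^e : r ∸ i < 2 ^ e
  r∸i<2^e = ≤-<-trans (m∸n≤m r i) (mod2^-< n e)
  n∸i≡ : n ∸ i ≡ (n ∸ r) + (r ∸ i)
  n∸i≡ = trans (cong (_∸ i) (sym (m∸n+n≡m (mod2^-≤ n e)))) (+-∸-assoc (n ∸ r) (<⇒≤ i<r))

2^e∣lcmUpTo : ∀ {e k} → 2 ^ e ≤ k → 2 ^ e ∣ℕ lcmUpTo k
2^e∣lcmUpTo {e} {k} 2^e≤k = Any∣⇒∣lcms (applyUpTo⁺ suc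
  -- The entry at index `pred (2 ^ e)` is `2 ^ e` itself.
  (subst (2 ^ e ∣ℕ_) (sym (suc-pred (2 ^ e))) ∣-refl) (subst (_≤ k) (sym (suc-pred (2 ^ e))) 2^e≤k))
  where instance _ = m^n≢0 2 e

2^1+e∤lcmUpTo : ∀ {e k} → k < 2 ^ suc e → 2 ^ suc e ∤ lcmUpTo k
2^1+e∤lcmUpTo {e} {k} k<2^1+e ∣U =
  let i , i<k , ∣1+i = applyUpTo⁻ suc (prime^∣lcms⇒Any∣ prime[2] e (applyUpTo suc k) ∣U)
  in >⇒∤ (≤-<-trans i<k k<2^1+e) ∣1+i

-- An even term, multiplied by the factor `2 ^ e` of `lcmUpTo k`, would put `2 ^ suc e` into
-- `lcmDown n k` and hence into some `n ∸ i` with `i` below the residue.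
term-odd : ∀ {n e k} → 2 ^ e ≤ k → k ≤ n mod2^ suc e → parity (term n k) ≡ 1ℙ
term-odd {n} {e} {k} 2^e≤k k≤r = 2∤⇒parity≡1 (term n k) λ 2∣t →
  let ∣D = subst (2 ^ suc e ∣ℕ_) (term-exact n k) (*-pres-∣ 2∣t (2^e∣lcmUpTo {e} 2^e≤k))
      i , i<k , ∣n∸i = applyUpTo⁻ (n ∸_) (prime^∣lcms⇒Any∣ prime[2] e (applyUpTo (n ∸_) k) ∣D)
  in 2^∤n∸i {n} {suc e} (<-≤-trans i<k k≤r) ∣n∸i

-- The entry `n ∸ r`, with `r` the residue, puts `2 ^ suc e` into `lcmDown n k`; an odd term would
-- push this whole power into `lcmUpTo k`.
term-even : ∀ {n e k} → k < 2 ^ suc e → n mod2^ suc e < k → parity (term n k) ≡ 0ℙ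
term-even {n} {e} {k} k<2^1+e r<k with 2 ∣? term n k
... | yes 2∣t = 2∣⇒parity≡0 2∣t
... | no  2∤t = contradiction
  (prime^∣*⇒prime^∣ʳ prime[2] (suc e) (term n k) (lcmUpTo k) 2∤t
    (subst (2 ^ suc e ∣ℕ_) (sym (term-exact n k))
      (Any∣⇒∣lcms (applyUpTo⁺ (n ∸_) (2^∣n∸mod2^ n (suc e)) r<k))))
  (2^1+e∤lcmUpTo {e} k<2^1+e)

-- For `k` beyond `n` the entry `n ∸ n` makes `lcmDown n k` zero. The sum can thus be extended up to
-- a power of two.
term-zero : ∀ {n k} → n < k → term n k ≡ 0
term-zero {n} {k} n<k = m*n≡0⇒m≡0 (term n k) (lcmUpTo k) (trans (term-exact n k)
  (0∣⇒≡0 (Any∣⇒∣lcms (applyUpTo⁺ (n ∸_) (subst (0 ∣ℕ_) (sym (n∸n≡0 n)) ∣-refl) n<k))))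
  where instance _ = lcmUpTo≢0 k

-- Parity of the sum over dyadic blocks

sum-applyUpTo-+ : ∀ (f : ℕ → ℕ) i j →
  sum (applyUpTo f (i + j)) ≡ sum (applyUpTo f i) + sum (applyUpTo (f ∘ _+_ i) j)
sum-applyUpTo-+ f zero    j = refl
sum-applyUpTo-+ f (suc i) j =
  trans (cong (_+_ (f 0)) (sum-applyUpTo-+ (f ∘ suc) i j)) (sym (+-assoc (f 0) _ _))

sum-applyUpTo-zero : ∀ {f : ℕ → ℕ} n → (∀ i → f i ≡ 0) → sum (applyUpTo f n) ≡ 0
sum-applyUpTo-zero zero    f≡0 = refl
sum-applyUpTo-zero (suc n) f≡0 = cong₂ _+_ (f≡0 0) (sum-applyUpTo-zero n (f≡0 ∘ suc))

parity-+-cong : ∀ {i i′ j j′} → parity i ≡ parity i′ → parity j ≡ parity j′ →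
                parity (i + j) ≡ parity (i′ + j′)
parity-+-cong {i} {i′} {j} {j′} p q =
  trans (ℙ.+-homo-+ i j) (trans (cong₂ _+ℙ_ p q) (sym (ℙ.+-homo-+ i′ j′)))

parity-sum-cong : ∀ {f g : ℕ → ℕ} n → (∀ i → parity (f i) ≡ parity (g i)) →
                  parity (sum (applyUpTo f n)) ≡ parity (sum (applyUpTo g n))
parity-sum-cong zero    f≡g = refl
parity-sum-cong {f} {g} (suc n) f≡g =
  parity-+-cong {f 0} {g 0} (f≡g 0) (parity-sum-cong n (f≡g ∘ suc))

parity-sum-threshold : ∀ {f : ℕ → ℕ} n c → c ≤ n →
  (∀ {i} → i < c → parity (f i) ≡ 1ℙ) →
  (∀ {i} → i < n → c ≤ i → parity (f i) ≡ 0ℙ) →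
  parity (sum (applyUpTo f n)) ≡ parity c
parity-sum-threshold zero zero _ _ _ = refl
parity-sum-threshold {f} (suc n) zero _ odd even = parity-+-cong {f 0} {0} {_} {0} (even z<s z≤n)
  (parity-sum-threshold n 0 z≤n (λ ()) (λ i<n _ → even (s<s i<n) z≤n))
parity-sum-threshold {f} (suc n) (suc c) (s≤s c≤n) odd even = parity-+-cong {f 0} {1} {_} {c} (odd z<s)
  (parity-sum-threshold n c c≤n (odd ∘ s<s) (λ i<n c≤i → even (s<s i<n) (s≤s c≤i)))

-- Counts the `k` with `2 ^ e ≤ k ≤ n mod2^ suc e`; truncation gives 0 when there are none.
oddTerms : ℕ → ℕ → ℕ
oddTerms n e = suc (n mod2^ suc e) ∸ 2 ^ e

parity-block : ∀ n e → parity (sum (applyUpTo (term n ∘ _+_ (2 ^ e)) (2 ^ e))) ≡ parity (oddTerms n e)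
parity-block n e = parity-sum-threshold (2 ^ e) (oddTerms n e) c≤2^e odd even
  where
  q = 2 ^ e
  r = n mod2^ suc e
  2q≡q+q : 2 ^ suc e ≡ q + q
  2q≡q+q = cong (_+_ q) (+-identityʳ q)
  c≤2^e : oddTerms n e ≤ q
  c≤2^e = m≤n+o⇒m∸n≤o (suc r) q (subst (r <_) 2q≡q+q (mod2^-< n (suc e)))
  odd : ∀ {i} → i < oddTerms n e → parity (term n (q + i)) ≡ 1ℙ
  -- By contraposition: `q + i` beyond `r` would place `i` at or above the threshold.
  odd {i} i<c = term-odd {n} {e} (m≤m+n q i) (m<1+n⇒m≤n (≰⇒> λ 1+r≤q+i →
    <⇒≱ i<c (m≤n+o⇒m∸n≤o (suc r) q 1+r≤q+i)))
  even : ∀ {i} → i < q → oddTerms n e ≤ i → parity (term n (q + i)) ≡ 0ℙ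
  even {i} i<q c≤i = term-even {n} {e} (subst (q + i <_) (sym 2q≡q+q) (+-monoʳ-< q i<q))
    (≤-trans (m≤n+m∸n (suc r) q) (+-monoʳ-≤ q c≤i))

-- The range from 0 to `2 ^ E ∸ 1` consists of `k = 0` and the blocks with `e < E`. The `suc`
-- accounts for `term n 0`, which is 1.
parity-blocks : ∀ n E →
  parity (sum (applyUpTo (term n) (2 ^ E))) ≡ parity (suc (sum (applyUpTo (oddTerms n) E)))
parity-blocks n zero    = refl
parity-blocks n (suc E) = begin
  parity (sum (applyUpTo (term n) (2 ^ E + (2 ^ E + 0))))
    ≡⟨ cong (λ j → parity (sum (applyUpTo (term n) (2 ^ E + j)))) (+-identityʳ (2 ^ E)) ⟩
  parity (sum (applyUpTo (term n) (2 ^ E + 2 ^ E)))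
    ≡⟨ cong parity (sum-applyUpTo-+ (term n) (2 ^ E) (2 ^ E)) ⟩
  parity (sum (applyUpTo (term n) (2 ^ E)) + sum (applyUpTo (term n ∘ _+_ (2 ^ E)) (2 ^ E)))
    ≡⟨ parity-+-cong {sum (applyUpTo (term n) (2 ^ E))} {suc (sum (applyUpTo (oddTerms n) E))}
         (parity-blocks n E) (parity-block n E) ⟩
  parity (suc (sum (applyUpTo (oddTerms n) E) + oddTerms n E))
    ≡⟨ cong (parity ∘ suc) sum-last ⟨
  parity (suc (sum (applyUpTo (oddTerms n) (suc E)))) ∎
  where
  open ≡-Reasoning
  sum-last : sum (applyUpTo (oddTerms n) (suc E)) ≡ sum (applyUpTo (oddTerms n) E) + oddTerms n E
  sum-last = begin
    sum (applyUpTo (oddTerms n) (suc E))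
      ≡⟨ cong (sum ∘ applyUpTo (oddTerms n)) (+-comm E 1) ⟨
    sum (applyUpTo (oddTerms n) (E + 1))
      ≡⟨ sum-applyUpTo-+ (oddTerms n) E 1 ⟩
    sum (applyUpTo (oddTerms n) E) + (oddTerms n (E + 0) + 0)
      ≡⟨ cong (_+_ (sum (applyUpTo (oddTerms n) E)))
           (trans (+-identityʳ _) (cong (oddTerms n) (+-identityʳ E))) ⟩
    sum (applyUpTo (oddTerms n) E) + oddTerms n E ∎

n<2^n : ∀ n → n < 2 ^ n
n<2^n zero    = z<s
n<2^n (suc n) = +-mono-≤ (m^n>0 2 n) (≤-trans (n<2^n n) (m≤m+n (2 ^ n) 0))

-- The additional 1 is `term n 0`, and all terms past `n` vanish.
suc-a≡ : ∀ {n E} → n ≤ E → suc (a n) ≡ sum (applyUpTo (term n) (2 ^ E))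
suc-a≡ {n} {E} n≤E = begin
  suc (a n)
    ≡⟨ +-identityʳ (suc (a n)) ⟨
  suc (a n) + 0
    ≡⟨ cong (_+_ (suc (a n))) (sum-applyUpTo-zero (2 ^ E ∸ suc n) λ i → term-zero (m≤m+n (suc n) i)) ⟨
  sum (applyUpTo (term n) (suc n)) + sum (applyUpTo (term n ∘ _+_ (suc n)) (2 ^ E ∸ suc n))
    ≡⟨ sum-applyUpTo-+ (term n) (suc n) (2 ^ E ∸ suc n) ⟨
  sum (applyUpTo (term n) (suc n + (2 ^ E ∸ suc n)))
    ≡⟨ cong (sum ∘ applyUpTo (term n)) (m+[n∸m]≡n (<-≤-trans (n<2^n n) (^-monoʳ-≤ 2 n≤E))) ⟩
  sum (applyUpTo (term n) (2 ^ E)) ∎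
  where open ≡-Reasoning

suc-parity-injective : ∀ {i j} → parity (suc i) ≡ parity (suc j) → parity i ≡ parity j
suc-parity-injective {i} {j} eq =
  trans (sym (ℙ.suc-homo-⁻¹ i)) (trans (cong _⁻¹ eq) (ℙ.suc-homo-⁻¹ j))

-- `E` stays free so that the number of blocks can be fitted to a digit list.
parity-a : ∀ {n E} → n ≤ E → parity (a n) ≡ parity (sum (applyUpTo (oddTerms n) E))
parity-a {n} {E} n≤E =
  suc-parity-injective {a n} {sum (applyUpTo (oddTerms n) E)}
    (trans (cong parity (suc-a≡ n≤E)) (parity-blocks n E))

-- Block counts from binary digits

-- The shape `toℕ b + n * 2` is the one `fromDigits` unfolds to, so block counts can be followed
-- digit by digit.
mod2^-digit : ∀ (b : Bit) n e → (toℕ b + n * 2) mod2^ suc e ≡ toℕ b + n mod2^ e * 2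
mod2^-digit b n e = begin
  (toℕ b + n * 2) % (2 * 2 ^ e)     ≡⟨ %-congʳ (*-comm 2 (2 ^ e)) ⟩
  (toℕ b + n * 2) % (2 ^ e * 2)     ≡⟨ %-congˡ (+-comm (toℕ b) (n * 2)) ⟩
  (n * 2 + toℕ b) % (2 ^ e * 2)     ≡⟨ [m*n+o]%[p*n]≡[m*n]%[p*n]+o n (2 ^ e) (Fin.toℕ<n b) ⟩
  (n * 2) % (2 ^ e * 2) + toℕ b     ≡⟨ cong (_+ toℕ b) (m%n*o≡m*o%[n*o] n (2 ^ e) 2) ⟨
  n % 2 ^ e * 2 + toℕ b             ≡⟨ +-comm _ (toℕ b) ⟩
  toℕ b + n % 2 ^ e * 2             ∎
  where
  open ≡-Reasoning
  instance
    _ = m^n≢0 2 e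
    _ = m^n≢0 2 (suc e)
    _ = m*n≢0 (2 ^ e) 2

parity-*2 : ∀ n → parity (n * 2) ≡ 0ℙ
parity-*2 n = 2∣⇒parity≡0 (n∣m*n n)

parity-1+*2 : ∀ n → parity (suc (n * 2)) ≡ 1ℙ
parity-1+*2 zero    = refl
parity-1+*2 (suc n) = parity-1+*2 n

-- Both sides are odd iff j ≤ i.
parity-∸-digit : ∀ (b : Bit) i j →
  parity (suc ((toℕ b + i * 2) * 2) ∸ j * 2 * 2) ≡ parity (suc (i * 2) ∸ j * 2)
parity-∸-digit b          i       zero    = trans (parity-1+*2 (toℕ b + i * 2)) (sym (parity-1+*2 i))
parity-∸-digit zero       zero    (suc j) = refl
parity-∸-digit (suc zero) zero    (suc j) = refl
parity-∸-digit zero       (suc i) (suc j) = parity-∸-digit zero i j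
parity-∸-digit (suc zero) (suc i) (suc j) = parity-∸-digit (suc zero) i j

oddTerms-digit-zero : ∀ b n → oddTerms (toℕ b + n * 2) 0 ≡ toℕ b
oddTerms-digit-zero b n = begin
  -- At `e = 0` the count `suc r ∸ 1` computes to the residue `r`.
  (toℕ b + n * 2) mod2^ 1 ≡⟨ mod2^-digit b n 0 ⟩
  toℕ b + n % 1 * 2       ≡⟨ cong (λ r → toℕ b + r * 2) (n%1≡0 n) ⟩
  toℕ b + 0               ≡⟨ +-identityʳ (toℕ b) ⟩
  toℕ b                   ∎
  where open ≡-Reasoning

oddTerms-digit-suc : ∀ b n e →
  oddTerms (toℕ b + n * 2) (suc e) ≡ suc (toℕ b + n mod2^ suc e * 2) ∸ 2 ^ e * 2
oddTerms-digit-suc b n e =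
  cong₂ (λ r q → suc r ∸ q) (mod2^-digit b n (suc e)) (*-comm 2 (2 ^ e))

-- A lowest digit 1 makes the residue odd, so its successor is even, as is `2 ^ suc e`; the count is
-- a doubled difference.
oddTerms-odd : ∀ n e → parity (oddTerms (1 + n * 2) (suc e)) ≡ 0ℙ
oddTerms-odd n e = begin
  parity (oddTerms (1 + n * 2) (suc e))
    ≡⟨ cong parity (oddTerms-digit-suc 1b n e) ⟩
  parity (suc (n mod2^ suc e) * 2 ∸ 2 ^ e * 2)
    ≡⟨ cong parity (*-distribʳ-∸ 2 (suc (n mod2^ suc e)) (2 ^ e)) ⟨
  parity ((suc (n mod2^ suc e) ∸ 2 ^ e) * 2)
    ≡⟨ parity-*2 (suc (n mod2^ suc e) ∸ 2 ^ e) ⟩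
  0ℙ ∎
  where open ≡-Reasoning

-- Dropping the digit `b` lowers the block index by one. Both counts are odd exactly when
-- `2 ^ e ≤ n mod2^ suc e`, that is, when the digit of index `e` of `n` is 1.
oddTerms-even-digit : ∀ b n e → parity (oddTerms ((toℕ b + n * 2) * 2) (suc (suc e))) ≡
                                parity (oddTerms (n * 2) (suc e))
oddTerms-even-digit b n e = begin
  parity (oddTerms ((toℕ b + n * 2) * 2) (suc (suc e)))
    ≡⟨ cong parity (oddTerms-digit-suc 0b (toℕ b + n * 2) (suc e)) ⟩
  parity (suc ((toℕ b + n * 2) mod2^ suc (suc e) * 2) ∸ 2 * 2 ^ e * 2)
    ≡⟨ cong₂ (λ r q → parity (suc (r * 2) ∸ q * 2)) (mod2^-digit b n (suc e)) (*-comm 2 (2 ^ e)) ⟩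
  parity (suc ((toℕ b + n mod2^ suc e * 2) * 2) ∸ 2 ^ e * 2 * 2)
    ≡⟨ parity-∸-digit b (n mod2^ suc e) (2 ^ e) ⟩
  parity (suc (n mod2^ suc e * 2) ∸ 2 ^ e * 2)
    ≡⟨ cong parity (oddTerms-digit-suc 0b n e) ⟨
  parity (oddTerms (n * 2) (suc e)) ∎
  where open ≡-Reasoning

oddTerms-even-lowest : ∀ b n → parity (oddTerms ((toℕ b + n * 2) * 2) 1) ≡ parity (toℕ b)
oddTerms-even-lowest b n = begin
  parity (oddTerms ((toℕ b + n * 2) * 2) 1)
    ≡⟨ cong parity (oddTerms-digit-suc 0b (toℕ b + n * 2) 0) ⟩
  parity (suc ((toℕ b + n * 2) mod2^ 1 * 2) ∸ 2)
    ≡⟨ cong (λ r → parity (suc (r * 2) ∸ 2)) (oddTerms-digit-zero b n) ⟩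
  parity (suc (toℕ b * 2) ∸ 2)
    ≡⟨ parity-bit b ⟩
  parity (toℕ b) ∎
  where
  open ≡-Reasoning
  parity-bit : ∀ (b : Bit) → parity (suc (toℕ b * 2) ∸ 2) ≡ parity (toℕ b)
  parity-bit zero       = refl
  parity-bit (suc zero) = refl

-- The count inside `s₂`, freed from `toDigits` to allow induction on arbitrary digit lists.
ones : Expansion 2 → ℕ
ones ds = length (filter (Fin._≟ 1b) ds)

ones-∷ : ∀ b ds → ones (b ∷ ds) ≡ toℕ b + ones ds
ones-∷ zero       ds = refl
ones-∷ (suc zero) ds = refl

oddTerms-0 : ∀ e → oddTerms 0 (suc e) ≡ 0
oddTerms-0 e = trans (cong (λ r → suc r ∸ 2 ^ suc e) 0%2^≡0) (m≤n⇒m∸n≡0 (m^n>0 2 (suc e)))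
  where
  0%2^≡0 : 0 mod2^ suc (suc e) ≡ 0
  0%2^≡0 = n≤0⇒n≡0 (mod2^-≤ 0 (suc (suc e)))

-- Induction on the digits: block 1 reads off the lowest one, and the later blocks are those of the
-- remaining digits shifted by one. The `k` surplus blocks past the top digit are empty.
parity-ones : ∀ (ds : Expansion 2) k →
  parity (sum (applyUpTo (oddTerms (fromDigits ds * 2) ∘ suc) (length ds + k))) ≡ parity (ones ds)
parity-ones []       k = cong parity (sum-applyUpTo-zero k oddTerms-0)
parity-ones (b ∷ ds) k = trans
  (parity-+-cong {oddTerms (fromDigits (b ∷ ds) * 2) 1} {toℕ b} {_} {ones ds}
    (oddTerms-even-lowest b (fromDigits ds))
    (trans (parity-sum-cong (length ds + k) (oddTerms-even-digit b (fromDigits ds)))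
           (parity-ones ds k)))
  (cong parity (sym (ones-∷ b ds)))

-- Parity of `a` and the congruence

parity-a-odd : ∀ n → parity (a (1 + n * 2)) ≡ 1ℙ
parity-a-odd n = trans (parity-a {1 + n * 2} ≤-refl) (parity-+-cong {oddTerms (1 + n * 2) 0} {1} {_} {0}
  (cong parity (oddTerms-digit-zero 1b n))
  (trans (parity-sum-cong {oddTerms (1 + n * 2) ∘ suc} {λ _ → 0} (n * 2) (oddTerms-odd n))
         (cong parity (sum-applyUpTo-zero (n * 2) λ _ → refl))))

parity-a-even : ∀ n → parity (a (n * 2)) ≡ parity (s₂ n)
parity-a-even n with toDigits 2 n
... | ds , refl = trans (parity-a n*2≤E)
  (parity-+-cong {oddTerms (n * 2) 0} {0} {_} {ones ds}
    (cong parity (oddTerms-digit-zero 0b n))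
    -- A surplus of `n * 2` blocks makes the bound required by `parity-a` immediate.
    (parity-ones ds (n * 2)))
  where
  n*2≤E : n * 2 ≤ suc (length ds + n * 2)
  n*2≤E = m≤n⇒m≤1+n (m≤n+m (n * 2) (length ds))

parity-t̄ : ∀ n → parity (t̄ n) ≡ parity (s₂ n) ⁻¹
parity-t̄ n with parity (s₂ n)
... | 0ℙ = refl
... | 1ℙ = refl

-- The congruence in additive form, which avoids subtraction in the naturals.
parity-a+m : ∀ n → parity (a n + m n) ≡ 1ℙ
parity-a+m n with n divMod 2
... | result q zero refl = begin
  parity (a (q * 2) + m (q * 2))            ≡⟨ ℙ.+-homo-+ (a (q * 2)) (m (q * 2)) ⟩
  parity (a (q * 2)) +ℙ parity (m (q * 2))  ≡⟨ cong₂ _+ℙ_ (parity-a-even q) parity-m ⟩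
  parity (s₂ q) +ℙ parity (s₂ q) ⁻¹         ≡⟨ p+p⁻¹≡1 (parity (s₂ q)) ⟩
  1ℙ                                        ∎
  where
  open ≡-Reasoning
  parity-m : parity (m (q * 2)) ≡ parity (s₂ q) ⁻¹
  parity-m = trans (cong (parity ∘ m) (*-comm q 2)) (trans (cong parity (m-even q)) (parity-t̄ q))
  p+p⁻¹≡1 : ∀ p → p +ℙ p ⁻¹ ≡ 1ℙ
  p+p⁻¹≡1 0ℙ = refl
  p+p⁻¹≡1 1ℙ = refl
... | result q (suc zero) refl = parity-+-cong {a (1 + q * 2)} {1} {_} {0} (parity-a-odd q)
  (cong parity (trans (cong (m ∘ suc) (*-comm q 2)) (m-odd q)))

parity≡1⇒2∣1+ : ∀ n → parity n ≡ 1ℙ → 2 ∣ℕ suc n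
parity≡1⇒2∣1+ 1             _  = ∣-refl
parity≡1⇒2∣1+ (suc (suc n)) eq = ∣m∣n⇒∣m+n ∣-refl (parity≡1⇒2∣1+ n eq)

lemma9 : ∀ (n : ℕ) → n ≥ 1 → + 2 ∣ (+ a n) - (1ℤ - + m n)
-- The difference equals `(1 + (a n + m n)) - 2`, and `suc (a n + m n)` is even.
lemma9 n _ = subst (+ 2 ∣_) (rearrange (+ a n) (+ m n))
  (ℤ.∣m∣n⇒∣m-n {m = + suc (a n + m n)}
    (ℤ.∣ᵤ⇒∣ (parity≡1⇒2∣1+ (a n + m n) (parity-a+m n))) (ℤ.∣-refl {+ 2}))
  where
  rearrange : ∀ x y → (1ℤ ℤ.+ (x ℤ.+ y)) - + 2 ≡ x - (1ℤ - y)
  rearrange = solve-∀
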